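{- Let $G$ be a resistance regular graph. Then $G$ has no cut vertex.
   Context: All graphs are finite, simple, undirected and connected. A cut vertex of a connected graph $G$ is a vertex whose deletion disconnects $G$. The resistance distance $r_{ij}$ is the effective resistance between vertices $i$ and $j$ when each edge of $G$ carries a unit resistance; equivalently (known fact) $r_{ij}=L_{ii}^++L_{jj}^+-2L_{ij}^+$, where $L^+$ is the Moore-Penrose inverse of the Laplacian matrix $L=D-A$ of $G$. The resistance matrix is $R(G)=(r_{ij})$. A connected graph $G$ is resistance regular if all row sums of $R(G)$ are equal. -}

module Defs where

open import Level using (0ℓ)
open import Data.Nat.Base using (ℕ; suc)
open import Data.Fin.Base using (Fin; punchIn)
open import Data.Fin.Properties using (_≟_)
open import Data.Bool.Base using (Bool; if_then_else_)
open import Data.Product.Base using (∃; _×_)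
open import Data.Rational using (ℚ; 0ℚ; 1ℚ; _*_; _-_)
open import Data.Rational.Properties using (+-0-commutativeMonoid)
open import Algebra.Properties.CommutativeMonoid.Sum +-0-commutativeMonoid using (sum)
open import Relation.Binary.Core using (Rel)
open import Relation.Binary.Definitions using (Symmetric; Irreflexive; Decidable)
open import Relation.Binary.Construct.Closure.ReflexiveTransitive using (Star)
open import Relation.Binary.PropositionalEquality using (_≡_; refl)
open import Relation.Nullary using (¬_; does)

record Graph (n : ℕ) : Set₁ where
  infix 4 _~_ _~?_
  field
    _~_      : Rel (Fin n) 0ℓ
    _~?_     : Decidable _~_
    ~-sym    : Symmetric _~_
    ~-irrefl : Irreflexive _≡_ _~_

open Graph

Connected : ∀ {n} → Graph n → Set
Connected G = ∀ u v → Star (_~_ G) u v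

-- punchIn c enumerates the vertices other than c, so this is the subgraph
-- induced on the complement of c.
delete : ∀ {n} → Graph (suc n) → Fin (suc n) → Graph n
delete G c = record
  { _~_      = λ i j → _~_ G (punchIn c i) (punchIn c j)
  ; _~?_     = λ i j → _~?_ G (punchIn c i) (punchIn c j)
  ; ~-sym    = ~-sym G
  ; ~-irrefl = λ { refl → ~-irrefl G refl }
  }

-- The one-vertex graph has no cut vertex: Connected holds for the graph on
-- no vertices.
CutVertex : ∀ {n} → Graph (suc n) → Fin (suc n) → Set
CutVertex G c = ¬ Connected (delete G c)

indicator : Bool → ℚ
indicator b = if b then 1ℚ else 0ℚ

-- By Ohm's law the current along a unit resistor from x to y is φ x - φ y.
netCurrent : ∀ {n} → Graph n → (Fin n → ℚ) → Fin n → ℚ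
netCurrent G φ x = sum λ y → indicator (does (_~?_ G x y)) * (φ x - φ y)

-- Kirchhoff's current law when a unit current enters at i and leaves at j.
UnitFlowPotential : ∀ {n} → Graph n → Fin n → Fin n → (Fin n → ℚ) → Set
UnitFlowPotential G i j φ =
  ∀ x → netCurrent G φ x ≡ indicator (does (x ≟ i)) - indicator (does (x ≟ j))

-- Potentials solve a linear system with rational coefficients, which on a
-- connected graph is solvable, uniquely up to an additive constant. Hence
-- rational potentials suffice and r is determined by G, i and j.
EffectiveResistance : ∀ {n} → Graph n → Fin n → Fin n → ℚ → Set
EffectiveResistance G i j r = ∃ λ φ → UnitFlowPotential G i j φ × r ≡ φ i - φ j

ResistanceMatrix : ∀ {n} → Graph n → (Fin n → Fin n → ℚ) → Set
ResistanceMatrix G R = ∀ i j → EffectiveResistance G i j (R i j)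

ResistanceRegular : ∀ {n} → Graph n → Set
ResistanceRegular G =
  Connected G ×
  ∃ λ R → ResistanceMatrix G R × (∀ i j → sum (R i) ≡ sum (R j))

{-# OPTIONS --safe #-}
module Submission where

-- Let c separate G and write s k = -1 for k on the side of i (i ≠ c) and s k = 1
-- for all other k, including c. Then R i k - R c k ≥ s k * R i c for every k: on
-- the side of i this is the triangle inequality, elsewhere resistances add in
-- series across c. Summing over k, equality of the rows i and c and R i c > 0
-- give Σ s ≤ 0. For a vertex on the other side the sign vector s' satisfies the
-- same bound, but s + s' is 2 at c and 0 elsewhere. The facts about resistances
-- follow from the maximum principle for potentials and superposition.

open import Data.Nat.Base using (ℕ; zero; suc)
open import Data.Fin.Base using (Fin; zero; suc; punchIn; punchOut)
open import Data.Fin.Properties using (_≟_; punchIn-punchOut; punchInᵢ≢i; sequence)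
open import Data.Bool.Base using (Bool; true; false; not; if_then_else_)
open import Data.List.Base using (allFin)
open import Data.List.Membership.Propositional.Properties using (∈-allFin)
import Data.List.Relation.Unary.All as All
open import Data.Product.Base using (_,_; proj₁; proj₂)
open import Data.Rational using (ℚ; 0ℚ; 1ℚ; _+_; _*_; _-_; -_; _≤_; _<_; positive)
open import Data.Rational.Properties
  using ( ≤-refl; ≤-reflexive; ≤-trans; ≤-antisym; ≤-decTotalOrder; ≰⇒>; <-irrefl; <-≤-trans
        ; +-0-commutativeMonoid; +-*-commutativeRing; module ≤-Reasoning
        ; +-identityˡ; +-identityʳ; +-inverseʳ; +-mono-≤; +-monoˡ-≤; +-monoʳ-≤; +-monoˡ-<
        ; *-identityˡ; *-zeroˡ; *-zeroʳ; *-cancelʳ-≤-pos; nonNegative⁻¹; positive⁻¹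
        ; neg-antimono-≤; neg-distrib-+; +-0-group )
open import Data.Rational.Solver using (module +-*-Solver)
open import Data.Vec.Functional using (insertAt)
open import Data.Vec.Functional.Properties using (insertAt-punchIn)
open import Algebra.Bundles using (CommutativeRing)
open import Algebra.Properties.Group +-0-group using (⁻¹-involutive)
open import Algebra.Properties.CommutativeMonoid.Sum +-0-commutativeMonoid
  using (sum; sum-cong-≗; sum-remove; sum-replicate-zero; ∑-distrib-+)
open import Algebra.Properties.Semiring.Sum (CommutativeRing.semiring +-*-commutativeRing)
  using (*-distribʳ-sum)
open import Effect.Monad using (RawMonad)
open import Function.Base using (_∘_; case_of_)
open import Function.Bundles using (mk⇔)
open import Level using (0ℓ)
open import Relation.Binary.Bundles using (DecTotalOrder)
open import Relation.Binary.Construct.Closure.ReflexiveTransitive using (Star; ε; _◅_; _◅◅_)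
open import Relation.Binary.PropositionalEquality
open import Relation.Nullary using (¬_; Dec; yes; no; does)
open import Relation.Nullary.Decidable
  using (dec-true; dec-false; does-⇔; ¬¬-excluded-middle; decidable-stable)
open import Relation.Nullary.Negation using (¬¬-Monad; ¬¬-map)
open import Data.List.Extrema (DecTotalOrder.totalOrder ≤-decTotalOrder)
  using (argmax; f[xs]≤f[argmax])
open import Defs

open +-*-Solver using (solve; con; _:+_; _:*_; _:-_; _:=_; :-_)

-- Order, finite sums and indicators over the rationals.

<⇒≱ : ∀ {p q} → p < q → ¬ q ≤ p
<⇒≱ p<q q≤p = <-irrefl refl (<-≤-trans p<q q≤p)

neg-cancel-≤ : ∀ {p q} → - p ≤ - q → q ≤ p
neg-cancel-≤ {p} {q} -p≤-q =
  subst₂ _≤_ (⁻¹-involutive q) (⁻¹-involutive p) (neg-antimono-≤ -p≤-q)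

p≤q⇒0≤q-p : ∀ {p q} → p ≤ q → 0ℚ ≤ q - p
p≤q⇒0≤q-p {p} {q} p≤q = subst (_≤ q - p) (+-inverseʳ p) (+-monoˡ-≤ (- p) p≤q)

-[p-q]≡q-p : ∀ p q → - (p - q) ≡ q - p
-[p-q]≡q-p = solve 2 (λ p q → :- (p :- q) := q :- p) refl

0≤q-p⇒p≤q : ∀ {p q} → 0ℚ ≤ q - p → p ≤ q
0≤q-p⇒p≤q {p} {q} 0≤q-p =
  subst₂ _≤_ (+-identityˡ p) (solve 2 (λ p q → q :- p :+ p := q) refl p q) (+-monoˡ-≤ p 0≤q-p)

sum-mono-≤ : ∀ {n} {f g : Fin n → ℚ} → (∀ i → f i ≤ g i) → sum f ≤ sum g
sum-mono-≤ {zero}  f≤g = ≤-refl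
sum-mono-≤ {suc n} f≤g = +-mono-≤ (f≤g zero) (sum-mono-≤ (f≤g ∘ suc))

sum-nonNeg : ∀ {n} {f : Fin n → ℚ} → (∀ i → 0ℚ ≤ f i) → 0ℚ ≤ sum f
sum-nonNeg {zero}  0≤f = ≤-refl
sum-nonNeg {suc n} 0≤f = +-mono-≤ (0≤f zero) (sum-nonNeg (0≤f ∘ suc))

term≤sum : ∀ {n} {f : Fin n → ℚ} → (∀ i → 0ℚ ≤ f i) → ∀ i → f i ≤ sum f
term≤sum {suc n} {f} 0≤f i =
  subst₂ _≤_ (+-identityʳ (f i)) (sym (sum-remove f))
    (+-monoʳ-≤ (f i) (sum-nonNeg (0≤f ∘ punchIn i)))

sum-neg : ∀ {n} (f : Fin n → ℚ) → sum (λ i → - f i) ≡ - sum f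
sum-neg {zero}  f = refl
sum-neg {suc n} f =
  trans (cong (- f zero +_) (sum-neg (f ∘ suc))) (sym (neg-distrib-+ (f zero) _))

indicator-*-cong : ∀ {P : Set} (P? : Dec P) {p q} → (P → p ≡ q) →
                   indicator (does P?) * p ≡ indicator (does P?) * q
indicator-*-cong (yes a) eq = cong (1ℚ *_) (eq a)
indicator-*-cong (no _) {p} {q} eq = trans (*-zeroˡ p) (sym (*-zeroˡ q))

indicator-*-nonNeg : ∀ {P : Set} (P? : Dec P) {p} → 0ℚ ≤ p → 0ℚ ≤ indicator (does P?) * p
indicator-*-nonNeg (yes _) {p} 0≤p = subst (0ℚ ≤_) (sym (*-identityˡ p)) 0≤p
indicator-*-nonNeg (no _)  {p} 0≤p = ≤-reflexive (sym (*-zeroˡ p))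

indicator-*-yes : ∀ {P : Set} (P? : Dec P) → P → ∀ p → indicator (does P?) * p ≡ p
indicator-*-yes P? a p = trans (cong (λ b → indicator b * p) (dec-true P? a)) (*-identityˡ p)

indicator-nonNeg : ∀ b → 0ℚ ≤ indicator b
indicator-nonNeg true  = nonNegative⁻¹ 1ℚ
indicator-nonNeg false = ≤-refl

-- Separations at a vertex and their sign vectors.

-- P is a union of components of G - c; its value at c is irrelevant.
Separates : ∀ {n} → Graph n → Fin n → (Fin n → Bool) → Set
Separates G c P = ∀ {x y} → Graph._~_ G x y → x ≢ c → y ≢ c → P x ≡ P y

Separates-not : ∀ {n} (G : Graph n) {c P} → Separates G c P → Separates G c (not ∘ P)
Separates-not G sep x~y x≢c y≢c = cong not (sep x~y x≢c y≢c)

truncate : ∀ {n} → (Fin n → Bool) → Fin n → (Fin n → ℚ) → Fin n → ℚ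
truncate P c φ x = if P x then φ x else φ c

truncate-true : ∀ {n} (P : Fin n → Bool) c φ {x} → P x ≡ true → truncate P c φ x ≡ φ x
truncate-true P c φ Px rewrite Px = refl

truncate-false : ∀ {n} (P : Fin n → Bool) c φ {x} → P x ≡ false → truncate P c φ x ≡ φ c
truncate-false P c φ ¬Px rewrite ¬Px = refl

truncate-cut : ∀ {n} (P : Fin n → Bool) c φ → truncate P c φ c ≡ φ c
truncate-cut P c φ with P c
... | true  = refl
... | false = refl

-- The sign vector `s` of the overview. The sign at `c` is fixed to `1ℚ` before `P` is consulted, so
-- `P` and its complement agree there and cancel everywhere else.
side : ∀ {n} → Fin n → (Fin n → Bool) → Fin n → ℚ
side c P k = if does (k ≟ c) then 1ℚ else (if P k then - 1ℚ else 1ℚ)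

side+side-nonNeg : ∀ {n} (c : Fin n) P k → 0ℚ ≤ side c P k + side c (not ∘ P) k
side+side-nonNeg c P k with k ≟ c
... | yes _ = nonNegative⁻¹ _
... | no  _ with P k
...   | true  = ≤-refl
...   | false = ≤-refl

side+side-cut : ∀ {n} (c : Fin n) P → 0ℚ < side c P c + side c (not ∘ P) c
side+side-cut c P rewrite dec-true (c ≟ c) refl = positive⁻¹ _

side-sums-positive : ∀ {n} (c : Fin n) P → 0ℚ < sum (side c P) + sum (side c (not ∘ P))
side-sums-positive c P = begin-strict
  0ℚ                                              <⟨ side+side-cut c P ⟩
  side c P c + side c (not ∘ P) c                 ≤⟨ term≤sum (side+side-nonNeg c P) c ⟩
  sum (λ k → side c P k + side c (not ∘ P) k)     ≡⟨ ∑-distrib-+ (side c P) (side c (not ∘ P)) ⟩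
  sum (side c P) + sum (side c (not ∘ P))         ∎
  where open ≤-Reasoning

-- Linearity of the net current and its sign at a maximum.

module _ {n} (G : Graph n) where
  open Graph G

  netCurrent-cong : ∀ φ ψ {x} → (∀ y → x ~ y → φ x - φ y ≡ ψ x - ψ y) →
                    netCurrent G φ x ≡ netCurrent G ψ x
  netCurrent-cong φ ψ {x} eq = sum-cong-≗ λ y → indicator-*-cong (x ~? y) (eq y)

  netCurrent-const : ∀ φ {x} → (∀ y → x ~ y → φ x ≡ φ y) → netCurrent G φ x ≡ 0ℚ
  netCurrent-const φ {x} eq = begin
    netCurrent G φ x
      ≡⟨ netCurrent-cong φ (λ _ → 0ℚ) (λ y x~y → trans (cong (λ p → φ x - p) (sym (eq y x~y))) (+-inverseʳ (φ x))) ⟩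
    sum (λ y → indicator (does (x ~? y)) * 0ℚ)
      ≡⟨ sum-cong-≗ (λ y → *-zeroʳ (indicator (does (x ~? y)))) ⟩
    sum {n} (λ _ → 0ℚ)                                  ≡⟨ sum-replicate-zero n ⟩
    0ℚ                                                  ∎
    where open ≡-Reasoning

  current : (Fin n → ℚ) → Fin n → Fin n → ℚ
  current φ x y = indicator (does (x ~? y)) * (φ x - φ y)

  current-+ : ∀ φ ψ x y → current (λ z → φ z + ψ z) x y ≡ current φ x y + current ψ x y
  current-+ φ ψ x y =
    solve 5 (λ a p q r s → a :* ((p :+ q) :- (r :+ s)) := a :* (p :- r) :+ a :* (q :- s)) refl
      (indicator (does (x ~? y))) (φ x) (ψ x) (φ y) (ψ y)

  current-neg : ∀ φ x y → current (λ z → - φ z) x y ≡ - current φ x y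
  current-neg φ x y =
    solve 3 (λ a p r → a :* ((:- p) :- (:- r)) := :- (a :* (p :- r))) refl
      (indicator (does (x ~? y))) (φ x) (φ y)

  netCurrent-+ : ∀ φ ψ x → netCurrent G (λ y → φ y + ψ y) x ≡ netCurrent G φ x + netCurrent G ψ x
  netCurrent-+ φ ψ x = trans (sum-cong-≗ (current-+ φ ψ x)) (∑-distrib-+ (current φ x) (current ψ x))

  netCurrent-neg : ∀ φ x → netCurrent G (λ y → - φ y) x ≡ - netCurrent G φ x
  netCurrent-neg φ x = trans (sum-cong-≗ (current-neg φ x)) (sum-neg (current φ x))

  current-nonNeg : ∀ φ {x} → (∀ z → φ z ≤ φ x) → ∀ y → 0ℚ ≤ current φ x y
  current-nonNeg φ {x} φ≤φx y = indicator-*-nonNeg (x ~? y) (p≤q⇒0≤q-p (φ≤φx y))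

  -- At a maximum no current flows in along any edge, so every term of the net current is
  -- nonnegative. A nonpositive sum then bounds each single term by zero, in particular the one of
  -- the edge to `y`.
  max-spreads : ∀ φ {x y} → netCurrent G φ x ≤ 0ℚ → (∀ z → φ z ≤ φ x) → x ~ y → φ x ≤ φ y
  max-spreads φ {x} {y} Lφx≤0 φ≤φx x~y = 0≤q-p⇒p≤q (begin
    0ℚ                                              ≡⟨⟩
    - 0ℚ                                            ≤⟨ neg-antimono-≤ Lφx≤0 ⟩
    - netCurrent G φ x
      ≤⟨ neg-antimono-≤ (term≤sum (current-nonNeg φ φ≤φx) y) ⟩
    - current φ x y                                 ≡⟨ cong -_ (indicator-*-yes (x ~? y) x~y _) ⟩
    - (φ x - φ y)                                   ≡⟨ -[p-q]≡q-p (φ x) (φ y) ⟩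
    φ y - φ x                                       ∎)
    where open ≤-Reasoning

  reverse : ∀ {i j} φ → UnitFlowPotential G i j φ → UnitFlowPotential G j i (λ x → - φ x)
  reverse {i} {j} φ flow x = begin
    netCurrent G (λ y → - φ y) x                               ≡⟨ netCurrent-neg φ x ⟩
    - netCurrent G φ x                                         ≡⟨ cong -_ (flow x) ⟩
    - (indicator (does (x ≟ i)) - indicator (does (x ≟ j)))
      ≡⟨ -[p-q]≡q-p (indicator (does (x ≟ i))) _ ⟩
    indicator (does (x ≟ j)) - indicator (does (x ≟ i))        ∎
    where open ≡-Reasoning

  off-source-nonPos : ∀ {i j} φ {x} → UnitFlowPotential G i j φ → x ≢ i → netCurrent G φ x ≤ 0ℚ
  off-source-nonPos {i} {j} φ {x} flow x≢i = begin
    netCurrent G φ x                                        ≡⟨ flow x ⟩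
    indicator (does (x ≟ i)) - indicator (does (x ≟ j))
      ≡⟨ cong (λ b → indicator b - indicator (does (x ≟ j))) (dec-false (x ≟ i) x≢i) ⟩
    0ℚ - indicator (does (x ≟ j))                           ≡⟨ +-identityˡ _ ⟩
    - indicator (does (x ≟ j))
      ≤⟨ neg-antimono-≤ (indicator-nonNeg (does (x ≟ j))) ⟩
    0ℚ                                                      ∎
    where open ≤-Reasoning

-- Maximum principle and superposition on a connected graph.

module ConnectedGraph {n} (G : Graph (suc n)) (connected : Connected G) where
  open Graph G

  -- Take a vertex where `φ` is largest and follow a path from it to `i`: by `max-spreads` each
  -- vertex that is left is followed by another maximum.
  maximum-principle : ∀ φ i → (∀ x → x ≢ i → netCurrent G φ x ≤ 0ℚ) → ∀ x → φ x ≤ φ i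
  maximum-principle φ i Lφ≤0 = along (connected top i) λ x →
    All.lookup (f[xs]≤f[argmax] {f = φ} zero (allFin (suc n))) (∈-allFin x)
    where
    top = argmax φ zero (allFin (suc n))
    along : ∀ {x} → Star _~_ x i → (∀ y → φ y ≤ φ x) → ∀ y → φ y ≤ φ i
    along ε φ≤φx = φ≤φx
    along {x} (x~z ◅ path) φ≤φx with x ≟ i
    -- The path may meet `i` before its end; the walk stops there, since nothing is known about the
    -- net current at `i`.
    ... | yes refl = φ≤φx
    ... | no x≢i = along path λ y → ≤-trans (φ≤φx y) (max-spreads G φ (Lφ≤0 x x≢i) φ≤φx x~z)

  -- The truncated potential is constant off the side and has the same currents
  -- on it, so the global maximum principle applies.
  maximum-principle-side : ∀ {c P} → Separates G c P → ∀ φ →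
    (∀ x → P x ≡ true → x ≢ c → netCurrent G φ x ≤ 0ℚ) → ∀ {x} → P x ≡ true → φ x ≤ φ c
  maximum-principle-side {c} {P} sep φ Lφ≤0 {x} Px =
    subst₂ _≤_ (truncate-true P c φ Px) (truncate-cut P c φ) (maximum-principle ψ c Lψ≤0 x)
    where
    ψ = truncate P c φ

    inside : ∀ {z y} → z ≢ c → P z ≡ true → z ~ y → ψ y ≡ φ y
    inside {y = y} z≢c Pz z~y with y ≟ c
    ... | yes refl = truncate-cut P c φ
    ... | no y≢c   = truncate-true P c φ (trans (sym (sep z~y z≢c y≢c)) Pz)

    outside : ∀ {z y} → z ≢ c → P z ≡ false → z ~ y → ψ y ≡ φ c
    outside {y = y} z≢c ¬Pz z~y with y ≟ c
    ... | yes refl = truncate-cut P c φ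
    ... | no y≢c   = truncate-false P c φ (trans (sym (sep z~y z≢c y≢c)) ¬Pz)

    Lψ≤0 : ∀ z → z ≢ c → netCurrent G ψ z ≤ 0ℚ
    Lψ≤0 z z≢c = on-side (P z) refl
      where
      on-side : ∀ b → P z ≡ b → netCurrent G ψ z ≤ 0ℚ
      on-side true Pz = subst (_≤ 0ℚ)
        (netCurrent-cong G φ ψ λ y z~y → sym (cong₂ _-_ (truncate-true P c φ Pz) (inside z≢c Pz z~y)))
        (Lφ≤0 z Pz z≢c)
      on-side false ¬Pz = ≤-reflexive
        (netCurrent-const G ψ λ y z~y → trans (truncate-false P c φ ¬Pz) (sym (outside z≢c ¬Pz z~y)))

  source-max : ∀ {i j} φ → UnitFlowPotential G i j φ → ∀ x → φ x ≤ φ i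
  source-max {i} φ flow = maximum-principle φ i λ _ → off-source-nonPos G φ flow

  sink-min : ∀ {i j} φ → UnitFlowPotential G i j φ → ∀ x → φ j ≤ φ x
  sink-min φ flow x = neg-cancel-≤ (source-max (λ y → - φ y) (reverse G φ flow) x)

  -- Without a drop, `source-max` and `sink-min` squeeze `φ` to a constant, whose net current at `i`
  -- is zero although a unit current enters there.
  potential-drop-positive : ∀ {i j} φ → i ≢ j → UnitFlowPotential G i j φ → φ j < φ i
  potential-drop-positive {i} {j} φ i≢j flow = ≰⇒> λ φi≤φj →
    <⇒≱ (positive⁻¹ 1ℚ) (begin
      1ℚ
        ≡⟨ cong₂ (λ a b → indicator a - indicator b) (dec-true (i ≟ i) refl) (dec-false (i ≟ j) i≢j) ⟨
      indicator (does (i ≟ i)) - indicator (does (i ≟ j))  ≡⟨ flow i ⟨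
      netCurrent G φ i
        ≡⟨ netCurrent-const G φ (λ y _ → ≤-antisym (≤-trans φi≤φj (sink-min φ flow y)) (source-max φ flow y)) ⟩
      0ℚ                                                   ∎)
    where open ≤-Reasoning

  -- With no source anywhere, the maximum principle applies with every vertex in the role of `i`, so
  -- every vertex is a maximum.
  harmonic-const : ∀ φ → (∀ x → netCurrent G φ x ≡ 0ℚ) → ∀ x y → φ x ≡ φ y
  harmonic-const φ Lφ≡0 x y = ≤-antisym (φ≤ y x) (φ≤ x y)
    where
    φ≤ : ∀ i z → φ z ≤ φ i
    φ≤ i = maximum-principle φ i λ z _ → ≤-reflexive (Lφ≡0 z)

  -- The currents of `φ` and `ψ` add up to a unit flow from `i` to `k`, so `φ + ψ - χ` is harmonic
  -- and hence constant.
  superposition : ∀ {i j k} φ ψ χ →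
    UnitFlowPotential G i j φ → UnitFlowPotential G j k ψ → UnitFlowPotential G i k χ →
    ∀ x y → χ x - χ y ≡ (φ x - φ y) + (ψ x - ψ y)
  superposition {i} {j} {k} φ ψ χ flow-ij flow-jk flow-ik x y = begin
    χ x - χ y                       ≡⟨ solve 2 (λ p d → p :- (d :- d) := p) refl (χ x - χ y) (δ x) ⟨
    χ x - χ y - (δ x - δ x)
      -- Constancy of `δ` enters by replacing one of the two cancelling copies of `δ x` by `δ y`.
      ≡⟨ cong (λ d → χ x - χ y - (d - δ x)) (harmonic-const δ Lδ≡0 x y) ⟩
    χ x - χ y - (δ y - δ x)
      ≡⟨ solve 6 (λ a b c d e f → e :- f :- ((b :+ d :- f) :- (a :+ c :- e)) := (a :- b) :+ (c :- d)) refl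
                                           (φ x) (φ y) (ψ x) (ψ y) (χ x) (χ y) ⟩
    (φ x - φ y) + (ψ x - ψ y)       ∎
    where
    open ≡-Reasoning
    e : Fin (suc n) → Fin (suc n) → ℚ
    e z l = indicator (does (z ≟ l))
    δ : Fin (suc n) → ℚ
    δ z = φ z + ψ z - χ z
    Lδ≡0 : ∀ z → netCurrent G δ z ≡ 0ℚ
    Lδ≡0 z = begin
      netCurrent G δ z
        ≡⟨ netCurrent-+ G (λ w → φ w + ψ w) (λ w → - χ w) z ⟩
      netCurrent G (λ w → φ w + ψ w) z + netCurrent G (λ w → - χ w) z
        ≡⟨ cong₂ _+_ (netCurrent-+ G φ ψ z) (reverse G χ flow-ik z) ⟩
      netCurrent G φ z + netCurrent G ψ z + (e z k - e z i)
        ≡⟨ cong (_+ (e z k - e z i)) (cong₂ _+_ (flow-ij z) (flow-jk z)) ⟩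
      (e z i - e z j) + (e z j - e z k) + (e z k - e z i)
        ≡⟨ solve 3 (λ a b c → (a :- b) :+ (b :- c) :+ (c :- a) := a :- a) refl (e z i) (e z j) (e z k) ⟩
      e z i - e z i
        ≡⟨ +-inverseʳ (e z i) ⟩
      0ℚ ∎

  -- Inequalities between resistances.

  module _ {R} (resistance : ResistanceMatrix G R) where

    private
      φ : Fin (suc n) → Fin (suc n) → Fin (suc n) → ℚ
      φ i j = proj₁ (resistance i j)

      flow : ∀ i j → UnitFlowPotential G i j (φ i j)
      flow i j = proj₁ (proj₂ (resistance i j))

      R-drop : ∀ i j → R i j ≡ φ i j i - φ i j j
      R-drop i j = proj₂ (proj₂ (resistance i j))

    φ-superposition : ∀ i j k x y →
      φ i k x - φ i k y ≡ (φ i j x - φ i j y) + (φ j k x - φ j k y)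
    φ-superposition i j k =
      superposition (φ i j) (φ j k) (φ i k) (flow i j) (flow j k) (flow i k)

    R-refl : ∀ i → R i i ≡ 0ℚ
    R-refl i = trans (R-drop i i) (+-inverseʳ (φ i i i))

    R-positive : ∀ {i j} → i ≢ j → 0ℚ < R i j
    R-positive {i} {j} i≢j = subst₂ _<_ (+-inverseʳ (φ i j j)) (sym (R-drop i j))
      (+-monoˡ-< (- φ i j j) (potential-drop-positive (φ i j) i≢j (flow i j)))

    -- The flow from `c` to `k` is the flow from `i` to `k` minus the flow from `i` to `c`. Both
    -- have source `i`, where the potential is largest, so each drop between `c` and `k` is at most
    -- the full drop from `i`.
    R-triangle : ∀ i c k → R c k ≤ R i c + R i k
    R-triangle i c k = begin
      R c k                                                          ≡⟨ R-drop c k ⟩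
      φ c k c - φ c k k
        ≡⟨ solve 2 (λ p q → q := (p :+ q) :- p) refl (φ i c c - φ i c k) (φ c k c - φ c k k) ⟩
      (φ i c c - φ i c k) + (φ c k c - φ c k k) - (φ i c c - φ i c k)
        ≡⟨ cong (_- (φ i c c - φ i c k)) (φ-superposition i c k c k) ⟨
      (φ i k c - φ i k k) - (φ i c c - φ i c k)
        ≡⟨ solve 4 (λ a b c d → (a :- b) :- (c :- d) := (d :- c) :+ (a :- b)) refl (φ i k c) (φ i k k) (φ i c c) (φ i c k) ⟩
      (φ i c k - φ i c c) + (φ i k c - φ i k k)
        ≤⟨ +-mono-≤ (+-monoˡ-≤ (- φ i c c) (source-max (φ i c) (flow i c) k)) (+-monoˡ-≤ (- φ i k k) (source-max (φ i k) (flow i k) c)) ⟩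
      (φ i c i - φ i c c) + (φ i k i - φ i k k)
        ≡⟨ cong₂ _+_ (R-drop i c) (R-drop i k) ⟨
      R i c + R i k                                                  ∎
      where open ≤-Reasoning

    module _ {c P} (sep : Separates G c P) {i} (Pi : P i ≡ true) (i≢c : i ≢ c) where

      -- The half of the series law that the row estimate uses. By superposition `R i k` is the sum
      -- of the drops of `φ i c` and `φ c k` from `i` to `k`. The source of `φ i c` is not on the
      -- side of `k`, so there the potential stays below its value at `c`; dually, the sink of
      -- `φ c k` is not on the side of `i`.
      R-across : ∀ {k} → P k ≡ false → k ≢ c → R i c + R c k ≤ R i k
      R-across {k} ¬Pk k≢c = begin
        R i c + R c k                                ≡⟨ cong₂ _+_ (R-drop i c) (R-drop c k) ⟩
        (φ i c i - φ i c c) + (φ c k c - φ c k k)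
          ≤⟨ +-mono-≤ (+-monoʳ-≤ (φ i c i) (neg-antimono-≤ k-side)) (+-monoˡ-≤ (- φ c k k) i-side) ⟩
        (φ i c i - φ i c k) + (φ c k i - φ c k k)    ≡⟨ φ-superposition i c k i k ⟨
        φ i k i - φ i k k                            ≡⟨ R-drop i k ⟨
        R i k                                        ∎
        where
        open ≤-Reasoning
        k-side : φ i c k ≤ φ i c c
        k-side = maximum-principle-side (Separates-not G sep) (φ i c)
          (λ x ¬Px _ → off-source-nonPos G (φ i c) (flow i c) λ { refl →
           case trans (sym ¬Px) (cong not Pi) of λ () })
          (cong not ¬Pk)
        i-side : φ c k c ≤ φ c k i
        -- A lower bound is an upper bound for the negated potential, whose source is `k`; the
        -- absurd case rules out that `k` lies on the side of `i`.
        i-side = neg-cancel-≤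
          (maximum-principle-side sep (λ x → - φ c k x)
            (λ x Px _ → off-source-nonPos G (λ y → - φ c k y) (reverse G (φ c k) (flow c k)) λ { refl →
             case trans (sym Px) ¬Pk of λ () })
            Pi)

      side≤row-difference : ∀ k → side c P k * R i c ≤ R i k - R c k
      side≤row-difference k with k ≟ c
      ... | yes refl = ≤-reflexive (begin
        1ℚ * R i c       ≡⟨ *-identityˡ (R i c) ⟩
        R i c            ≡⟨ +-identityʳ (R i c) ⟨
        R i c - 0ℚ       ≡⟨ cong (λ p → R i c - p) (R-refl c) ⟨
        R i c - R c c    ∎)
        where open ≡-Reasoning
      ... | no k≢c with P k in Pk
      ...   | true  = 0≤q-p⇒p≤q (subst (0ℚ ≤_)
        (solve 3 (λ a b d → (a :+ b) :- d := (b :- d) :- ((:- con 1ℚ) :* a)) refl (R i c) (R i k) (R c k))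
        (p≤q⇒0≤q-p (R-triangle i c k)))
      ...   | false = 0≤q-p⇒p≤q (subst (0ℚ ≤_)
        (solve 3 (λ a b d → b :- (a :+ d) := (b :- d) :- (con 1ℚ :* a)) refl (R i c) (R i k) (R c k))
        (p≤q⇒0≤q-p (R-across Pk k≢c)))

      sum-side-nonPos : sum (R i) ≡ sum (R c) → sum (side c P) ≤ 0ℚ
      sum-side-nonPos regular = *-cancelʳ-≤-pos (R i c) {{positive (R-positive i≢c)}} (begin
        sum (side c P) * R i c              ≡⟨ *-distribʳ-sum (R i c) (side c P) ⟩
        sum (λ k → side c P k * R i c)      ≤⟨ sum-mono-≤ side≤row-difference ⟩
        sum (λ k → R i k + - R c k)         ≡⟨ ∑-distrib-+ (R i) (λ k → - R c k) ⟩
        sum (R i) + sum (λ k → - R c k)     ≡⟨ cong₂ _+_ regular (sum-neg (R c)) ⟩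
        sum (R c) - sum (R c)               ≡⟨ +-inverseʳ (sum (R c)) ⟩
        0ℚ                                  ≡⟨ *-zeroˡ (R i c) ⟨
        0ℚ * R i c                          ∎)
        where open ≤-Reasoning

-- Regularity excludes separations and cut vertices.

regular⇒no-separation : ∀ {n} (G : Graph (suc n)) → ResistanceRegular G → ∀ {c P} → Separates G c P →
  ∀ {i j} → i ≢ c → j ≢ c → P i ≡ true → ¬ P j ≡ false
regular⇒no-separation G (connected , R , resistance , regular) {c} {P} sep {i} {j} i≢c j≢c Pi ¬Pj =
  -- The sign bound is used once for `P` with `i` and once for the complement with `j`; the
  -- resulting `0ℚ + 0ℚ` computes to `0ℚ`.
  <⇒≱ (side-sums-positive c P) (+-mono-≤
    (sum-side-nonPos resistance sep Pi i≢c (regular i c))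
    (sum-side-nonPos resistance (Separates-not G sep) (cong not ¬Pj) j≢c (regular j c)))
  where open ConnectedGraph G connected

module _ {n} (G : Graph (suc n)) (c : Fin (suc n)) where
  private
    Reach : Fin n → Fin n → Set
    Reach = Star (Graph._~_ (delete G c))

  module _ (reach? : ∀ u v → Dec (Reach u v)) where

    -- The value `true` at `c` is an arbitrary default: `Separates` and `side` both ignore it.
    component : Fin n → Fin (suc n) → Bool
    component u = insertAt (λ v → does (reach? u v)) c true

    -- An edge of `G` that avoids `c` survives in `delete G c`, and by symmetry a path from `u` to
    -- either end extends to the other.
    component-separates : ∀ u → Separates G c (component u)
    component-separates u {x} {y} x~y x≢c y≢c =
      subst₂ (λ x y → Graph._~_ G x y → component u x ≡ component u y)
        (punchIn-punchOut (x≢c ∘ sym)) (punchIn-punchOut (y≢c ∘ sym)) edge x~y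
      where
      edge : ∀ {v w} → Graph._~_ G (punchIn c v) (punchIn c w) →
             component u (punchIn c v) ≡ component u (punchIn c w)
      edge {v} {w} v~w = begin
        component u (punchIn c v)     ≡⟨ insertAt-punchIn _ c true v ⟩
        does (reach? u v)
          ≡⟨ does-⇔ (mk⇔ (_◅◅ (v~w ◅ ε)) (_◅◅ (Graph.~-sym G v~w ◅ ε))) (reach? u v) (reach? u w) ⟩
        does (reach? u w)             ≡⟨ insertAt-punchIn _ c true w ⟨
        component u (punchIn c w)     ∎
        where open ≡-Reasoning

    regular⇒delete-connected : ResistanceRegular G → Connected (delete G c)
    regular⇒delete-connected regular u v = decidable-stable (reach? u v) λ ¬reach →
      regular⇒no-separation G regular (component-separates u)
        (punchInᵢ≢i c u) (punchInᵢ≢i c v)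
        (trans (insertAt-punchIn _ c true u) (dec-true (reach? u u) ε))
        (trans (insertAt-punchIn _ c true v) (dec-false (reach? u v) ¬reach))

theorem2p13 : ∀ (n : ℕ) (G : Graph (suc n)) → ResistanceRegular G → ∀ (c : Fin (suc n)) → ¬ CutVertex G c
theorem2p13 n G regular c =
  -- The goal unfolds to the double negation of connectedness, so reachability may be taken as
  -- decided: the finitely many instances of excluded middle are collected under one double
  -- negation.
  ¬¬-map (λ reach? → regular⇒delete-connected G c reach? regular)
    (sequence ¬¬-applicative λ u → sequence ¬¬-applicative λ v → ¬¬-excluded-middle)
  where ¬¬-applicative = RawMonad.rawApplicative (¬¬-Monad {0ℓ})
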